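{- Let $G$ be an infinite closed subgroup of $\mathrm{Sym}(\mathbb{N})$ that is locally Roelcke precompact. Let $\mathcal{W}(G)$ be the set of cosets of Roelcke precompact open subgroups of $G$, together with $\emptyset$. Then the range of the natural monomorphism $\Gamma:\mathrm{Aut}(G)\to\mathrm{Sym}(\mathcal{W}(G))$, given by $\Gamma(\alpha)(A)=\alpha(A)$, is closed.
   Context: A topological group $G$ is Roelcke precompact if each open subgroup $U$ of $G$ has only finitely many double cosets $UgU$, $g\in G$. $G$ is locally Roelcke precompact if it has a Roelcke precompact open subgroup. $\mathrm{Aut}(G)$ is the group of bicontinuous automorphisms of $G$. For such $G$, $\mathcal{W}(G)$ is a countable basis of the topology of $G$ invariant under the action of $\mathrm{Aut}(G)$. $\mathrm{Sym}(X)$ for countable $X$ carries the topology of pointwise convergence ($X$ discrete), in which the pointwise stabilisers of finite subsets of $X$ form a neighbourhood basis of the identity. -}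

module Defs where

open import Algebra.Bundles using (Group)
open import Algebra.Morphism.Structures using (module GroupMorphisms)
open import Data.Empty using (⊥-elim)
open import Data.Fin.Base using (Fin)
open import Data.List.Base using (List; []; _∷_; _++_)
open import Data.List.Relation.Unary.All as All using (All)
open import Data.List.Relation.Unary.All.Properties using (++⁻ˡ; ++⁻ʳ)
open import Data.Nat.Base using (ℕ)
open import Data.Product.Base using (Σ; ∃; _×_; _,_; proj₁; proj₂)
open import Data.Sum.Base as Sum using (_⊎_; inj₁; inj₂)
open import Function.Base using (_∘_; _on_)
open import Function.Bundles using (Inverse; Injection)
open import Function.Construct.Composition as Comp using ()
open import Function.Construct.Identity as Id using ()
open import Function.Construct.Symmetry as Symm using ()
open import Level using (Level; _⊔_; suc; 0ℓ)
open import Relation.Binary.Bundles using (Setoid)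
open import Relation.Binary.Construct.On as On using ()
open import Relation.Binary.Definitions using (_Respects_)
import Relation.Binary.PropositionalEquality as ≡
open import Relation.Nullary.Negation using (¬_)
open import Relation.Unary using (Pred; _∈_; _⊆_; _≐_; Empty)
open import Relation.Unary.Properties using (≐-refl; ≐-sym; ≐-trans)
open import Relation.Unary.Relation.Binary.Equality using (≐-setoid)

open Inverse using (to; from; to-cong; from-cong; strictlyInverseˡ; strictlyInverseʳ)

private
  variable
    a ℓ ℓ₁ ℓ₂ p : Level

-- A set is finite when it embeds in some Fin n.  Classically this is the same as
-- being in bijection with some Fin n; unlike the latter it passes to subsets
-- without excluded middle.
Finite : Setoid a ℓ → Set (a ⊔ ℓ)
Finite S = ∃ λ n → Injection S (≡.setoid (Fin n))

Infinite : Setoid a ℓ → Set (a ⊔ ℓ)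
Infinite S = ¬ Finite S

module _ (X : Setoid a ℓ) where
  open Setoid X using (_≈_; refl; sym; trans)

  Sym : Group (a ⊔ ℓ) (a ⊔ ℓ)
  Sym = record
    { Carrier = Inverse X X
    ; _≈_     = λ f g → ∀ x → to f x ≈ to g x
    ; _∙_     = λ f g → Comp.inverse g f
    ; ε       = Id.inverse X
    ; _⁻¹     = Symm.inverse
    ; isGroup = record
      { isMonoid = record
        { isSemigroup = record
          { isMagma = record
            { isEquivalence = record
              { refl  = λ _ → refl
              ; sym   = λ f≈g x → sym (f≈g x)
              ; trans = λ f≈g g≈h x → trans (f≈g x) (g≈h x)
              }
            ; ∙-cong = λ {f} {f′} {g} {g′} f≈f′ g≈g′ x →
                trans (f≈f′ (to g x)) (to-cong f′ (g≈g′ x))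
            }
          ; assoc = λ _ _ _ _ → refl
          }
        ; identity = (λ _ _ → refl) , (λ _ _ → refl)
        }
      ; inverse = strictlyInverseʳ , strictlyInverseˡ
      ; ⁻¹-cong = λ {f} {g} f≈g x →
          sym (trans (from-cong g (trans (sym (strictlyInverseˡ f x)) (f≈g (from f x))))
                     (strictlyInverseʳ g (from f x)))
      }
    }

  -- For finite F, the sets { f ∣ f ≈[ F ] g } are the basic neighbourhoods of g
  -- in the topology of pointwise convergence, X being discrete.
  _≈[_]_ : Inverse X X → List (Setoid.Carrier X) → Inverse X X → Set (a ⊔ ℓ)
  f ≈[ F ] g = All (λ x → to f x ≈ to g x) F

  IsClosed : Pred (Inverse X X) p → Set (a ⊔ ℓ ⊔ p)
  IsClosed P = ∀ f → (∀ F → ∃ λ g → g ∈ P × f ≈[ F ] g) → f ∈ P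

ℕ-setoid : Setoid 0ℓ 0ℓ
ℕ-setoid = ≡.setoid ℕ

Perm : Set
Perm = Inverse ℕ-setoid ℕ-setoid

open Group (Sym ℕ-setoid) using (_≈_; _∙_; ε; _⁻¹; ∙-cong; ⁻¹-cong)
private module S = Group (Sym ℕ-setoid)

infix 4 _~[_]_

_~[_]_ : Perm → List ℕ → Perm → Set
_~[_]_ = _≈[_]_ ℕ-setoid

record Subgroup (ℓ : Level) : Set (suc ℓ) where
  field
    ∣_∣  : Pred Perm ℓ
    resp : ∣_∣ Respects _≈_
    ε∈   : ε ∈ ∣_∣
    ∙∈   : ∀ {g h} → g ∈ ∣_∣ → h ∈ ∣_∣ → g ∙ h ∈ ∣_∣
    ⁻¹∈  : ∀ {g} → g ∈ ∣_∣ → g ⁻¹ ∈ ∣_∣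

  El : Set ℓ
  El = Σ Perm ∣_∣

  group : Group ℓ 0ℓ
  group = record
    { Carrier = El
    ; _≈_     = _≈_ on proj₁
    ; _∙_     = λ (g , g∈) (h , h∈) → g ∙ h , ∙∈ g∈ h∈
    ; ε       = ε , ε∈
    ; _⁻¹     = λ (g , g∈) → g ⁻¹ , ⁻¹∈ g∈
    ; isGroup = record
      { isMonoid = record
        { isSemigroup = record
          { isMagma = record
            { isEquivalence = On.isEquivalence proj₁ S.isEquivalence
            ; ∙-cong = λ {(f , _)} {(f′ , _)} {(g , _)} {(g′ , _)} →
                ∙-cong {f} {f′} {g} {g′}
            }
          ; assoc = λ (f , _) (g , _) (h , _) → S.assoc f g h
          }
        ; identity = (λ (g , _) → S.identityˡ g) , (λ (g , _) → S.identityʳ g)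
        }
      ; inverse = (λ (g , _) → S.inverseˡ g) , (λ (g , _) → S.inverseʳ g)
      ; ⁻¹-cong = λ {(f , _)} {(g , _)} → ⁻¹-cong {f} {g}
      }
    }

  setoid : Setoid ℓ 0ℓ
  setoid = Group.setoid group

open Subgroup using (∣_∣; El; resp; ε∈; ∙∈; ⁻¹∈; group; setoid)

-- Openness in the subspace topology of G.
IsOpenIn : Subgroup ℓ → Pred Perm ℓ → Set ℓ
IsOpenIn G A = ∀ {g} → g ∈ A → ∃ λ F → ∀ {h} → h ∈ ∣ G ∣ → h ~[ F ] g → h ∈ A

IsOpenSubgroup : (G U : Subgroup ℓ) → Set ℓ
IsOpenSubgroup G U = ∣ U ∣ ⊆ ∣ G ∣ × IsOpenIn G ∣ U ∣

leftCoset : Perm → Subgroup ℓ → Pred Perm ℓ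
leftCoset g U h = ∃ λ u → u ∈ ∣ U ∣ × h ≈ g ∙ u

doubleCoset : Subgroup ℓ → Perm → Pred Perm ℓ
doubleCoset U g h = ∃ λ u → ∃ λ v → u ∈ ∣ U ∣ × v ∈ ∣ U ∣ × h ≈ u ∙ g ∙ v

-- The set { UgU ∣ g ∈ G }: a double coset is named by a representative g, and
-- two names are equal when the double cosets are equal as sets.
DoubleCosets : (G U : Subgroup ℓ) → Setoid ℓ ℓ
DoubleCosets {ℓ} G U = On.setoid (≐-setoid Perm ℓ) (doubleCoset U ∘ proj₁ {B = ∣ G ∣})

RoelckePrecompact : Subgroup ℓ → Set (suc ℓ)
RoelckePrecompact G = ∀ U → IsOpenSubgroup G U → Finite (DoubleCosets G U)

IsRPOpenSubgroup : (G U : Subgroup ℓ) → Set (suc ℓ)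
IsRPOpenSubgroup G U = IsOpenSubgroup G U × RoelckePrecompact U

LocallyRoelckePrecompact : Subgroup ℓ → Set (suc ℓ)
LocallyRoelckePrecompact G = ∃ (IsRPOpenSubgroup G)

-- Left cosets suffice: Ug = g(g⁻¹Ug) is a left coset of a conjugate of U, which
-- is Roelcke precompact open if U is.
IsRPOpenCoset : Subgroup ℓ → Pred Perm ℓ → Set (suc ℓ)
IsRPOpenCoset G A = ∃ λ U → IsRPOpenSubgroup G U × ∃ λ g → g ∈ ∣ G ∣ × A ≐ leftCoset g U

𝓦 : Subgroup ℓ → Setoid (suc ℓ) ℓ
𝓦 {ℓ} G = On.setoid (≐-setoid Perm ℓ)
  (proj₁ {B = λ A → Empty A ⊎ IsRPOpenCoset G A})

IsContinuous : (G : Subgroup ℓ) → (El G → El G) → Set ℓ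
IsContinuous G φ = ∀ g F → ∃ λ E → ∀ h →
  proj₁ h ~[ E ] proj₁ g → proj₁ (φ h) ~[ F ] proj₁ (φ g)

record Automorphism (G : Subgroup ℓ) : Set ℓ where
  open GroupMorphisms (Group.rawGroup (group G)) (Group.rawGroup (group G))
  field
    bijection       : Inverse (setoid G) (setoid G)
    isHomomorphism  : IsGroupHomomorphism (to bijection)
    to-continuous   : IsContinuous G (to bijection)
    from-continuous : IsContinuous G (from bijection)

  open Inverse bijection public using () renaming (to to fun; from to inv)
  open IsGroupHomomorphism isHomomorphism public

open Automorphism using (bijection; fun; inv)

module _ {G : Subgroup ℓ} where
  private
    module G = Group (group G)
    variable
      A B : Pred Perm ℓ

  idᴬ : Automorphism G
  idᴬ = record
    { bijection       = Id.inverse (setoid G)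
    ; isHomomorphism  = record
      { isMonoidHomomorphism = record
        { isMagmaHomomorphism = record
          { isRelHomomorphism = record { cong = λ p → p }
          ; homo = λ _ _ _ → ≡.refl
          }
        ; ε-homo = λ _ → ≡.refl
        }
      ; ⁻¹-homo = λ _ _ → ≡.refl
      }
    ; to-continuous   = λ _ F → F , λ _ p → p
    ; from-continuous = λ _ F → F , λ _ p → p
    }

  _∘ᴬ_ : Automorphism G → Automorphism G → Automorphism G
  α ∘ᴬ β = record
    { bijection       = Comp.inverse β.bijection α.bijection
    ; isHomomorphism  = record
      { isMonoidHomomorphism = record
        { isMagmaHomomorphism = record
          { isRelHomomorphism = record
            { cong = λ {g} {h} p → α.⟦⟧-cong {β.fun g} {β.fun h} (β.⟦⟧-cong {g} {h} p) }
          ; homo = λ g h → G.trans {α.fun (β.fun (g G.∙ h))} {α.fun (β.fun g G.∙ β.fun h)}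
              {α.fun (β.fun g) G.∙ α.fun (β.fun h)}
              (α.⟦⟧-cong {β.fun (g G.∙ h)} {β.fun g G.∙ β.fun h} (β.homo g h))
              (α.homo (β.fun g) (β.fun h))
          }
        ; ε-homo = G.trans {α.fun (β.fun G.ε)} {α.fun G.ε} {G.ε}
            (α.⟦⟧-cong {β.fun G.ε} {G.ε} β.ε-homo) α.ε-homo
        }
      ; ⁻¹-homo = λ g → G.trans {α.fun (β.fun (g G.⁻¹))} {α.fun (β.fun g G.⁻¹)}
          {α.fun (β.fun g) G.⁻¹}
          (α.⟦⟧-cong {β.fun (g G.⁻¹)} {β.fun g G.⁻¹} (β.⁻¹-homo g))
          (α.⁻¹-homo (β.fun g))
      }
    ; to-continuous   = λ g F →
        let E , p = α.to-continuous (β.fun g) F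
            D , q = β.to-continuous g E
        in  D , λ h → p (β.fun h) ∘ q h
    ; from-continuous = λ g F →
        let E , p = β.from-continuous (α.inv g) F
            D , q = α.from-continuous g E
        in  D , λ h → p (α.inv h) ∘ q h
    }
    where
    module α = Automorphism α
    module β = Automorphism β

  _⁻¹ᴬ : Automorphism G → Automorphism G
  α ⁻¹ᴬ = record
    { bijection       = Symm.inverse α.bijection
    ; isHomomorphism  = record
      { isMonoidHomomorphism = record
        { isMagmaHomomorphism = record
          { isRelHomomorphism = record
            { cong = λ {g} {h} → from-cong α.bijection {g} {h} }
          ; homo = λ g h → inv-unique (g G.∙ h) (α.inv g G.∙ α.inv h)
              (G.trans {α.fun (α.inv g G.∙ α.inv h)} {α.fun (α.inv g) G.∙ α.fun (α.inv h)} {g G.∙ h}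
                (α.homo (α.inv g) (α.inv h))
                (G.∙-cong {α.fun (α.inv g)} {g} {α.fun (α.inv h)} {h} (fun-inv g) (fun-inv h)))
          }
        ; ε-homo = inv-unique G.ε G.ε α.ε-homo
        }
      ; ⁻¹-homo = λ g → inv-unique (g G.⁻¹) (α.inv g G.⁻¹)
          (G.trans {α.fun (α.inv g G.⁻¹)} {α.fun (α.inv g) G.⁻¹} {g G.⁻¹}
            (α.⁻¹-homo (α.inv g)) (G.⁻¹-cong {α.fun (α.inv g)} {g} (fun-inv g)))
      }
    ; to-continuous   = α.from-continuous
    ; from-continuous = α.to-continuous
    }
    where
    module α = Automorphism α
    fun-inv = strictlyInverseˡ α.bijection

    inv-unique : ∀ g h → α.fun h G.≈ g → α.inv g G.≈ h
    inv-unique g h p = G.trans {α.inv g} {α.inv (α.fun h)} {h}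
      (from-cong α.bijection {g} {α.fun h} (G.sym {α.fun h} {g} p))
      (strictlyInverseʳ α.bijection h)

  image : Automorphism G → Pred Perm ℓ → Pred Perm ℓ
  image α A h = ∃ λ (g : El G) → proj₁ g ∈ A × proj₁ (fun α g) ≈ h

  image-mono : ∀ α → A ⊆ B → image α A ⊆ image α B
  image-mono α A⊆B (g , g∈A , αg≈h) = g , A⊆B g∈A , αg≈h

  image-cong : ∀ α → A ≐ B → image α A ≐ image α B
  image-cong {A} {B} α (A⊆B , B⊆A) =
    (λ {h} → image-mono {A} {B} α A⊆B {h}) , (λ {h} → image-mono {B} {A} α B⊆A {h})

  image-resp : ∀ α → image α A Respects _≈_
  image-resp α {h} {k} h≈k (g , g∈A , αg≈h) = g , g∈A , S.trans {proj₁ (fun α g)} {h} {k} αg≈h h≈k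

  image-⊆ : ∀ α → image α A ⊆ ∣ G ∣
  image-⊆ α {h} (g , _ , αg≈h) = resp G {proj₁ (fun α g)} {h} αg≈h (proj₂ (fun α g))

  image-inverse : ∀ α → A Respects _≈_ → A ⊆ ∣ G ∣ → image α (image (α ⁻¹ᴬ) A) ≐ A
  image-inverse {A = A} α A-resp A⊆G = (λ {h} → ⊆₁ {h}) , (λ {h} → ⊆₂ {h})
    where
    ⊆₁ : image α (image (α ⁻¹ᴬ) A) ⊆ A
    ⊆₁ {h} (g , (k , k∈A , α⁻¹k≈g) , αg≈h) = A-resp {proj₁ k} {h}
      (S.trans {proj₁ k} {proj₁ (fun α g)} {h}
        (S.sym {proj₁ (fun α g)} {proj₁ k}
          (proj₁ (Inverse.inverse (bijection α)) {k} {g} (S.sym {proj₁ (inv α k)} {proj₁ g} α⁻¹k≈g)))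
        αg≈h)
      k∈A

    ⊆₂ : A ⊆ image α (image (α ⁻¹ᴬ) A)
    ⊆₂ {h} h∈A = inv α k , (k , h∈A , λ _ → ≡.refl) , strictlyInverseˡ (bijection α) k
      where k = h , A⊆G h∈A

  imageSubgroup : Automorphism G → Subgroup ℓ → Subgroup ℓ
  imageSubgroup α U = record
    { ∣_∣  = image α ∣ U ∣
    ; resp = λ {h} {k} → image-resp α {h} {k}
    ; ε∈   = G.ε , ε∈ U , α.ε-homo
    ; ∙∈   = λ {h} {h′} (g , g∈U , αg≈h) (g′ , g′∈U , αg′≈h′) →
        g G.∙ g′ , ∙∈ U g∈U g′∈U ,
        S.trans {proj₁ (α.fun (g G.∙ g′))} {proj₁ (α.fun g) ∙ proj₁ (α.fun g′)} {h ∙ h′}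
          (α.homo g g′) (∙-cong {proj₁ (α.fun g)} {h} {proj₁ (α.fun g′)} {h′} αg≈h αg′≈h′)
    ; ⁻¹∈  = λ {h} (g , g∈U , αg≈h) →
        g G.⁻¹ , ⁻¹∈ U g∈U ,
        S.trans {proj₁ (α.fun (g G.⁻¹))} {proj₁ (α.fun g) ⁻¹} {h ⁻¹}
          (α.⁻¹-homo g) (⁻¹-cong {proj₁ (α.fun g)} {h} αg≈h)
    }
    where module α = Automorphism α

  image-open : ∀ α {K} → ∣ K ∣ ⊆ ∣ G ∣ → A ⊆ ∣ K ∣ → IsOpenIn K A →
    IsOpenIn (imageSubgroup α K) (image α A)
  image-open {A = A} α K⊆G A⊆K A-open {h} (g , g∈A , αg≈h) =
    let E , p = A-open g∈A
        F , q = Automorphism.from-continuous α (fun α g) E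
    in  F , λ {k} (k′ , k′∈K , αk′≈k) k~h →
      k′ , p k′∈K (near {E = E} k′ (q (fun α k′) (All.map
        (λ {x} kx≡hx → ≡.trans (αk′≈k x) (≡.trans kx≡hx (≡.sym (αg≈h x)))) k~h)))
         , αk′≈k
    where
    near : ∀ {E} k → proj₁ (inv α (fun α k)) ~[ E ] proj₁ (inv α (fun α g)) → proj₁ k ~[ E ] proj₁ g
    near k = All.map (λ {x} e → ≡.trans (≡.sym (strictlyInverseʳ (bijection α) k x))
      (≡.trans e (strictlyInverseʳ (bijection α) g x)))

  doubleCoset-resp : ∀ U g → doubleCoset {ℓ} U g Respects _≈_
  doubleCoset-resp U g {h} {k} h≈k (u , v , u∈U , v∈U , e) =
    u , v , u∈U , v∈U , S.trans {k} {h} {u ∙ g ∙ v} (S.sym {h} {k} h≈k) e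

  doubleCoset-cong : ∀ U {g h} → g ≈ h → doubleCoset {ℓ} U g ≐ doubleCoset U h
  doubleCoset-cong U {g} {h} g≈h = 
    (λ {k} → half g h g≈h {k}) , (λ {k} → half h g (S.sym {g} {h} g≈h) {k})
    where
    half : ∀ g h → g ≈ h → doubleCoset U g ⊆ doubleCoset U h
    half g h g≈h (u , v , u∈U , v∈U , e) =
      u , v , u∈U , v∈U , λ x → ≡.trans (e x) (≡.cong (to u) (g≈h (to v x)))

  doubleCoset-⊆ : ∀ (U : Subgroup ℓ) {g} → ∣ U ∣ ⊆ ∣ G ∣ → g ∈ ∣ G ∣ → doubleCoset U g ⊆ ∣ G ∣
  doubleCoset-⊆ U {g} U⊆G g∈G {h} (u , v , u∈U , v∈U , e) =
    resp G {u ∙ g ∙ v} {h} (S.sym {h} {u ∙ g ∙ v} e) (∙∈ G (∙∈ G (U⊆G u∈U) g∈G) (U⊆G v∈U))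

  image-doubleCoset : ∀ α U → ∣ U ∣ ⊆ ∣ G ∣ → ∀ k →
    doubleCoset (imageSubgroup α U) (proj₁ (fun α k)) ≐ image α (doubleCoset U (proj₁ k))
  image-doubleCoset α U U⊆G k = (λ {h} → ⊆₁ {h}) , (λ {h} → ⊆₂ {h})
    where
    open Automorphism α using (homo; ⟦⟧-cong)

    homo₃ : ∀ u v → proj₁ (fun α (u G.∙ k G.∙ v)) ≈
      proj₁ (fun α u) ∙ proj₁ (fun α k) ∙ proj₁ (fun α v)
    homo₃ u v x = ≡.trans (homo (u G.∙ k) v x) (homo u k (to (proj₁ (fun α v)) x))

    ⊆₁ : doubleCoset (imageSubgroup α U) (proj₁ (fun α k)) ⊆ image α (doubleCoset U (proj₁ k))
    ⊆₁ (u , v , (u′ , u′∈U , αu′≈u) , (v′ , v′∈U , αv′≈v) , e) =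
      u′ G.∙ k G.∙ v′ , (proj₁ u′ , proj₁ v′ , u′∈U , v′∈U , λ _ → ≡.refl) , λ x →
        ≡.trans (homo₃ u′ v′ x)
          (≡.trans (αu′≈u _)
            (≡.trans (≡.cong (to u ∘ to (proj₁ (fun α k))) (αv′≈v x)) (≡.sym (e x))))

    ⊆₂ : image α (doubleCoset U (proj₁ k)) ⊆ doubleCoset (imageSubgroup α U) (proj₁ (fun α k))
    ⊆₂ (g , (u , v , u∈U , v∈U , e) , αg≈h) =
      proj₁ (fun α u′) , proj₁ (fun α v′) ,
      (u′ , u∈U , λ _ → ≡.refl) , (v′ , v∈U , λ _ → ≡.refl) , λ x →
        ≡.trans (≡.sym (αg≈h x)) (≡.trans (⟦⟧-cong {g} {u′ G.∙ k G.∙ v′} e x) (homo₃ u′ v′ x))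
      where
      u′ = u , U⊆G u∈U
      v′ = v , U⊆G v∈U

  image-leftCoset : ∀ α U → ∣ U ∣ ⊆ ∣ G ∣ → ∀ g →
    image α (leftCoset (proj₁ g) U) ≐ leftCoset (proj₁ (fun α g)) (imageSubgroup α U)
  image-leftCoset α U U⊆G g =
    (λ { (h , (u , u∈U , e) , αh≈k) →
         let u′ = u , U⊆G u∈U in
         proj₁ (fun α u′) , (u′ , u∈U , λ _ → ≡.refl) , λ x →
           ≡.trans (≡.sym (αh≈k x)) (≡.trans (⟦⟧-cong {h} {g G.∙ u′} e x) (homo g u′ x)) }) ,
    (λ { (u , (u′ , u′∈U , αu′≈u) , e) →
         g G.∙ u′ , (proj₁ u′ , u′∈U , λ _ → ≡.refl) , λ x →
           ≡.trans (homo g u′ x) (≡.trans (≡.cong (to (proj₁ (fun α g))) (αu′≈u x)) (≡.sym (e x))) })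
    where open Automorphism α using (homo; ⟦⟧-cong)

  image-roelckePrecompact : ∀ α U → ∣ U ∣ ⊆ ∣ G ∣ →
    RoelckePrecompact U → RoelckePrecompact (imageSubgroup α U)
  image-roelckePrecompact α U U⊆G U-rp W (W⊆αU , W-open) = n , record
    { to        = f ∘ pre
    ; cong      = λ {k} {l} p → F.cong {pre k} {pre l}
        (≐-trans (pre-≐ k) (≐-trans (image-cong (α ⁻¹ᴬ) p) (≐-sym (pre-≐ l))))
    ; injective = λ {k} {l} p → ≐-trans (≐-sym (back k))
        (≐-trans (image-cong α
          (≐-trans (≐-sym (pre-≐ k)) (≐-trans (F.injective {pre k} {pre l} p) (pre-≐ l))))
          (back l))
    }
    where
    αU = imageSubgroup α U
    W′ = imageSubgroup (α ⁻¹ᴬ) W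

    W⊆G : ∣ W ∣ ⊆ ∣ G ∣
    W⊆G {w} w∈W = image-⊆ {A = ∣ U ∣} α {w} (W⊆αU w∈W)

    α⁻¹αU≐U : image (α ⁻¹ᴬ) ∣ αU ∣ ≐ ∣ U ∣
    α⁻¹αU≐U = image-inverse {A = ∣ U ∣} (α ⁻¹ᴬ) (λ {g} {h} → resp U {g} {h}) U⊆G

    W′-open : IsOpenSubgroup U W′
    W′-open =
      (λ {w} w∈W′ → proj₁ α⁻¹αU≐U {w} (image-mono {∣ W ∣} {∣ αU ∣} (α ⁻¹ᴬ) (λ {v} → W⊆αU {v}) {w} w∈W′)) ,
      λ {w} w∈W′ →
        let E , p = image-open {A = ∣ W ∣} (α ⁻¹ᴬ) {αU}
              (λ {v} → image-⊆ {A = ∣ U ∣} α {v}) (λ {v} → W⊆αU {v}) W-open {w} w∈W′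
        in  E , λ {h} h∈U → p {h} (proj₂ α⁻¹αU≐U {h} h∈U)

    n = proj₁ (U-rp W′ W′-open)
    module F = Injection (proj₂ (U-rp W′ W′-open))
    f = F.to

    pre : El αU → El U
    pre (_ , g , g∈U , _) = proj₁ g , g∈U

    inG : El αU → El G
    inG (k , k∈αU) = k , image-⊆ {A = ∣ U ∣} α {k} k∈αU

    pre-≐ : ∀ k → doubleCoset W′ (proj₁ (pre k)) ≐ image (α ⁻¹ᴬ) (doubleCoset W (proj₁ k))
    pre-≐ k@(_ , g , _ , αg≈k) = ≐-trans
      (doubleCoset-cong W′ {proj₁ g} {proj₁ (inv α (inG k))}
        (S.sym {proj₁ (inv α (inG k))} {proj₁ g}
          (proj₂ (Inverse.inverse (bijection α)) {g} {inG k}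
            (S.sym {proj₁ (fun α g)} {proj₁ k} αg≈k))))
      (image-doubleCoset (α ⁻¹ᴬ) W W⊆G (inG k))

    back : ∀ k → image α (image (α ⁻¹ᴬ) (doubleCoset W (proj₁ k))) ≐ doubleCoset W (proj₁ k)
    back k = image-inverse α (λ {g} {h} → doubleCoset-resp W (proj₁ k) {g} {h})
      (doubleCoset-⊆ W W⊆G (proj₂ (inG k)))

  image-coset : ∀ α → IsRPOpenCoset G A → IsRPOpenCoset G (image α A)
  image-coset {A = A} α (U , ((U⊆G , U-open) , U-rp) , g , g∈G , A≐gU) =
    imageSubgroup α U ,
    ( ( (λ {h} → image-⊆ {A = ∣ U ∣} α {h})
      , λ {h} h∈αU → let E , p = image-open {A = ∣ U ∣} α {G} (λ g∈ → g∈) U⊆G U-open {h} h∈αU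
                         in  E , λ {k} k∈G → p {k} (surj k∈G))
    , image-roelckePrecompact α U U⊆G U-rp ) ,
    proj₁ (fun α g′) , proj₂ (fun α g′) ,
    ≐-trans (image-cong {A} {leftCoset g U} α A≐gU) (image-leftCoset α U U⊆G g′)
    where
    g′ = g , g∈G

    surj : ∣ G ∣ ⊆ image α ∣ G ∣
    surj {k} k∈G = inv α (k , k∈G) , proj₂ (inv α (k , k∈G)) , strictlyInverseˡ (bijection α) (k , k∈G)

  act : Automorphism G → Setoid.Carrier (𝓦 G) → Setoid.Carrier (𝓦 G)
  act α (A , A∈𝓦) = image α A , Sum.map
    (λ { empty _ (g , g∈A , _) → empty (proj₁ g) g∈A }) (image-coset α) A∈𝓦

  𝓦-resp : ((A , _) : Setoid.Carrier (𝓦 G)) → A Respects _≈_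
  𝓦-resp (A , inj₁ empty) {g} _ g∈A = ⊥-elim (empty g g∈A)
  𝓦-resp (A , inj₂ (U , _ , c , _ , A⊆cU , cU⊆A)) {g} {h} g≈h g∈A =
    let u , u∈U , g≈cu = A⊆cU {g} g∈A
    in  cU⊆A {h} (u , u∈U , S.trans {h} {g} {c ∙ u} (S.sym {g} {h} g≈h) g≈cu)

  𝓦-⊆ : ((A , _) : Setoid.Carrier (𝓦 G)) → A ⊆ ∣ G ∣
  𝓦-⊆ (A , inj₁ empty) {g} g∈A = ⊥-elim (empty g g∈A)
  𝓦-⊆ (A , inj₂ (U , ((U⊆G , _) , _) , c , c∈G , A⊆cU , _)) {g} g∈A =
    let u , u∈U , g≈cu = A⊆cU {g} g∈A
    in  resp G {c ∙ u} {g} (S.sym {g} {c ∙ u} g≈cu) (∙∈ G c∈G (U⊆G u∈U))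

  image-inverse-𝓦 : ∀ α (A : Setoid.Carrier (𝓦 G)) → image α (image (α ⁻¹ᴬ) (proj₁ A)) ≐ proj₁ A
  image-inverse-𝓦 α A =
    image-inverse α (λ {g} {h} → 𝓦-resp A {g} {h}) (λ {g} → 𝓦-⊆ A {g})

  Γ : Automorphism G → Inverse (𝓦 G) (𝓦 G)
  Γ α = record
    { to        = act α
    ; from      = act (α ⁻¹ᴬ)
    ; to-cong   = image-cong α
    ; from-cong = image-cong (α ⁻¹ᴬ)
    ; inverse   =
        (λ {A} {B} p → ≐-trans (image-cong α p) (image-inverse-𝓦 α A)) ,
        (λ {A} {B} p → ≐-trans (image-cong (α ⁻¹ᴬ) p) (image-inverse-𝓦 (α ⁻¹ᴬ) A))
    }

module _ (G : Subgroup ℓ) where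
  private
    module G = Group (group G)
    module SymW = Group (Sym (𝓦 G))

  Aut : Group ℓ ℓ
  Aut = record
    { Carrier = Automorphism G
    ; _≈_     = λ α β → ∀ g → fun α g G.≈ fun β g
    ; _∙_     = _∘ᴬ_
    ; ε       = idᴬ
    ; _⁻¹     = _⁻¹ᴬ
    ; isGroup = record
      { isMonoid = record
        { isSemigroup = record
          { isMagma = record
            { isEquivalence = record
              { refl  = λ _ _ → ≡.refl
              ; sym   = λ p g x → ≡.sym (p g x)
              ; trans = λ p q g x → ≡.trans (p g x) (q g x)
              }
            ; ∙-cong = λ {α} {α′} {β} {β′} p q g → G.trans
                {fun α (fun β g)} {fun α′ (fun β g)} {fun α′ (fun β′ g)}
                (p (fun β g)) (to-cong (bijection α′) {fun β g} {fun β′ g} (q g))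
            }
          ; assoc = λ _ _ _ _ _ → ≡.refl
          }
        ; identity = (λ _ _ _ → ≡.refl) , (λ _ _ _ → ≡.refl)
        }
      ; inverse = (λ α → strictlyInverseʳ (bijection α)) , (λ α → strictlyInverseˡ (bijection α))
      ; ⁻¹-cong = λ {α} {β} p → Group.⁻¹-cong (Sym (setoid G)) {bijection α} {bijection β} p
      }
    }

  open GroupMorphisms (Group.rawGroup Aut) (Group.rawGroup (Sym (𝓦 G)))

  Γ-isGroupHomomorphism : IsGroupHomomorphism Γ
  Γ-isGroupHomomorphism = record
    { isMonoidHomomorphism = record
      { isMagmaHomomorphism = record
        { isRelHomomorphism = record
          { cong = λ {α} {β} p A →
              (λ {h} → half α β p (proj₁ A) {h}) ,
              (λ {h} → half β α (λ g x → ≡.sym (p g x)) (proj₁ A) {h}) }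
        ; homo = λ α β _ →
            (λ { (g , g∈A , αβg≈h) → fun β g , (g , g∈A , λ _ → ≡.refl) , αβg≈h }) ,
            (λ { (k , (g , g∈A , βg≈k) , αk≈h) → g , g∈A , λ x →
                 ≡.trans (to-cong (bijection α) {fun β g} {k} βg≈k x) (αk≈h x) })
        }
      ; ε-homo = λ A →
          (λ {h} (g , g∈A , g≈h) → 𝓦-resp {G = G} A {proj₁ g} {h} g≈h g∈A) ,
          (λ {h} h∈A → (h , 𝓦-⊆ {G = G} A {h} h∈A) , h∈A , λ _ → ≡.refl)
      }
    ; ⁻¹-homo = λ _ _ → ≐-refl
    }
    where
    half : ∀ α β → (∀ g → fun α g G.≈ fun β g) → ∀ A → image α A ⊆ image β A
    half α β p A (g , g∈A , αg≈h) = g , g∈A , λ x → ≡.trans (≡.sym (p g x)) (αg≈h x)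

  -- V ∩ (the pointwise stabiliser of F)
  fix : Subgroup ℓ → List ℕ → Subgroup ℓ
  fix V F = record
    { ∣_∣  = λ g → g ∈ ∣ V ∣ × g ~[ F ] ε
    ; resp = λ {g} {h} g≈h (g∈V , g~ε) →
        resp V {g} {h} g≈h g∈V , All.map (λ {x} → ≡.trans (≡.sym (g≈h x))) g~ε
    ; ε∈   = ε∈ V , All.universal (λ _ → ≡.refl) F
    ; ∙∈   = λ {g} {h} (g∈V , g~ε) (h∈V , h~ε) → ∙∈ V g∈V h∈V ,
        All.zipWith (λ (p , q) → ≡.trans (≡.cong (to g) q) p) (g~ε , h~ε)
    ; ⁻¹∈  = λ {g} (g∈V , g~ε) → ⁻¹∈ V g∈V ,
        All.map (λ {x} p → ≡.trans (≡.cong (from g) (≡.sym p)) (strictlyInverseʳ g x)) g~ε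
    }

  fix-isRPOpenSubgroup : ∀ V F → IsRPOpenSubgroup G V → IsRPOpenSubgroup G (fix V F)
  fix-isRPOpenSubgroup V F ((V⊆G , V-open) , V-rp) =
    ( V⊆G ∘ proj₁
    , λ {g} (g∈V , g~ε) → let E , p = V-open g∈V in
        E ++ F , λ h∈G h~g → p h∈G (++⁻ˡ E h~g) ,
          All.zipWith (λ (p , q) → ≡.trans p q) (++⁻ʳ E h~g , g~ε) ) ,
    λ U (U⊆fix , U-open) →
      let n , f = V-rp U (proj₁ ∘ U⊆fix , λ {g} g∈U →
            let E , p = U-open g∈U in
            E ++ F , λ {h} h∈V h~g → p {h}
              (h∈V , All.zipWith (λ (p , q) → ≡.trans p q) (++⁻ʳ E h~g , proj₂ (U⊆fix g∈U)))
              (++⁻ˡ E h~g))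
          module F = Injection f
      in n , record
        { to        = λ (g , g∈V , _) → F.to (g , g∈V)
        ; cong      = F.cong
        ; injective = F.injective
        }

  Γ-isGroupMonomorphism : LocallyRoelckePrecompact G → IsGroupMonomorphism Γ
  Γ-isGroupMonomorphism (V , V-rp) = record
    { isGroupHomomorphism = Γ-isGroupHomomorphism
    ; injective           = λ {α} {β} → Γ-injective α β
    }
    where
    -- With β(U) fixing x, α(g) ∈ α(gU) = β(gU) gives α(g)(x) = β(g)(x).
    Γ-injective : ∀ α β → Γ α SymW.≈ Γ β → ∀ g → fun α g G.≈ fun β g
    Γ-injective α β Γα≈Γβ g x =
      let E , p = Automorphism.to-continuous β G.ε (x ∷ [])
          U = fix V E
          gU = leftCoset (proj₁ g) U , inj₂ (U , fix-isRPOpenSubgroup V E V-rp , proj₁ g , proj₂ g , ≐-refl)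
          k , (u , (u∈V , u~ε) , k≈gu) , βk≈αg =
            proj₁ (Γα≈Γβ gU) {proj₁ (fun α g)} (g , (ε , ε∈ U , λ _ → ≡.refl) , λ _ → ≡.refl)
          u′ = u , proj₁ (proj₁ V-rp) u∈V
      in  ≡.trans (≡.sym (βk≈αg x))
            (≡.trans (to-cong (bijection β) {k} {g G.∙ u′} k≈gu x)
              (≡.trans (Automorphism.homo β g u′ x)
                (≡.cong (to (proj₁ (fun β g)))
                  (≡.trans (All.head (p u′ u~ε)) (Automorphism.ε-homo β x)))))

  Range-Γ : Pred (Inverse (𝓦 G) (𝓦 G)) (suc ℓ)
  Range-Γ π = ∃ λ (α : Automorphism G) → Γ α SymW.≈ π

{-# OPTIONS --safe #-}
module Submission where

open import Defs
open import Level using (Level)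
open import Algebra.Bundles using (Group)
open import Data.Empty using (⊥-elim)
open import Data.List.Base using (List; []; _∷_; _++_; map)
open import Data.List.Relation.Unary.All as All using (All; []; _∷_)
open import Data.List.Relation.Unary.All.Properties using (map⁺; map⁻; ++⁻ˡ; ++⁻ʳ)
open import Data.Nat.Base using (ℕ)
open import Data.Product.Base using (∃; _×_; _,_; proj₁; proj₂)
open import Data.Sum.Base using (inj₁; inj₂)
open import Function.Bundles using (Inverse)
import Function.Construct.Symmetry as Symm
open import Relation.Binary.Bundles using (Setoid)
open import Relation.Binary.PropositionalEquality using (_≡_; refl; sym; trans; cong; module ≡-Reasoning)
open import Relation.Unary using (Pred; _∈_; _≐_)
open import Relation.Unary.Properties using (≐-refl; ≐-sym; ≐-trans)

open Inverse using (to; from; to-cong; strictlyInverseˡ; strictlyInverseʳ)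
open Subgroup using (∣_∣; El; ε∈; ∙∈; ⁻¹∈; group)
open Automorphism using (fun)
open Group (Sym ℕ-setoid) using (_∙_; ε; _⁻¹)

-- Automorphisms αᵢ approximating π converge pointwise.  Choose an open subgroup U
-- with π(U) fixing x.  As soon as α agrees with π on the coset gU, the element α(g)
-- lies in π(gU), and all elements of π(gU) take the same value at x; this value is
-- taken as β(g)(x).  Any finite set of values of β is attained by a single
-- automorphism, so β is a homomorphism, and it maps into G because G is closed.
-- Moreover β(A) ⊆ π(A) for A in 𝓦(G), because the coset π(A) is uniformly open.
-- The same holds for π⁻¹ with a limit γ, and applying both inclusions to
-- gStab(x) shows that β and γ are mutually inverse.

module _ {ℓ : Level} (G : Subgroup ℓ) where
  private
    module G = Group (group G)
    W = Setoid.Carrier (𝓦 G)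

  -- Approximation of permutations of `𝓦 G` by automorphisms.

  Agrees : Inverse (𝓦 G) (𝓦 G) → Automorphism G → Pred W ℓ
  Agrees π α A = image α (proj₁ A) ≐ proj₁ (to π A)

  LeftInverseOf : (π ρ : Inverse (𝓦 G) (𝓦 G)) → Set _
  LeftInverseOf π ρ = ∀ A → proj₁ (to π (to ρ A)) ≐ proj₁ A

  Approximable : Inverse (𝓦 G) (𝓦 G) → Set _
  Approximable π = ∀ As → ∃ λ α → All (Agrees π α) As

  closure⇒approximable : ∀ π →
    (∀ As → ∃ λ ρ → ρ ∈ Range-Γ G × _≈[_]_ (𝓦 G) π As ρ) → Approximable π
  closure⇒approximable π near As =
    let ρ , (α , Γα≈ρ) , π≈ρ = near As
    in  α , All.map (λ {A} πA≐ρA → ≐-trans (Γα≈ρ A) (≐-sym πA≐ρA)) π≈ρ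

  -- If `α` agrees with `π` on each π⁻¹(A), then `α ⁻¹ᴬ` agrees with π⁻¹ on each A.
  approximable-inverse : ∀ π → Approximable π → Approximable (Symm.inverse π)
  approximable-inverse π approx As =
    let α , agrees = approx (map (from π) As)
    in  α ⁻¹ᴬ , All.map
          (λ {A} αA′≐A → proj₂ (Inverse.inverse (Γ α)) {from π A} {A}
            (≐-sym (≐-trans αA′≐A (strictlyInverseˡ π A))))
          (map⁻ agrees)

  -- Cosets and uniform openness.

  coset : ∀ U → IsRPOpenSubgroup G U → El G → W
  coset U U-rp (g , g∈G) = leftCoset g U , inj₂ (U , U-rp , g , g∈G , ≐-refl)

  ∈-leftCoset : ∀ (U : Subgroup ℓ) g → g ∈ leftCoset g U
  ∈-leftCoset U g = ε , ε∈ U , λ _ → refl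

  -- One `E` serves every `g`: if `h` and `g` agree on `E`, then `g ⁻¹ ∙ h` fixes `E` pointwise and
  -- so lies in `U`.
  open⇒∈-leftCoset : ∀ U → IsOpenSubgroup G U → ∃ λ E → ∀ {g h} → g ∈ ∣ G ∣ → h ∈ ∣ G ∣ →
    h ~[ E ] g → h ∈ leftCoset g U
  open⇒∈-leftCoset U (_ , U-open) =
    let E , near = U-open (ε∈ U)
    in  E , λ {g} {h} g∈G h∈G h~g →
          g ⁻¹ ∙ h ,
          near (∙∈ G (⁻¹∈ G g∈G) h∈G)
            (All.map (λ {x} e → trans (cong (from g) e) (strictlyInverseʳ g x)) h~g) ,
          λ x → sym (strictlyInverseˡ g (to h x))

  -- If A = cU and `h` is close to some `g` in cU, then `h` lies in gU, which is contained in cU;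
  -- how close depends on `U` alone.
  𝓦-uniformlyOpen : ((A , _) : W) → ∃ λ E → ∀ {g h} → g ∈ A → h ∈ ∣ G ∣ → h ~[ E ] g → h ∈ A
  𝓦-uniformlyOpen (A , inj₁ empty) = [] , λ {g} g∈A → ⊥-elim (empty g g∈A)
  𝓦-uniformlyOpen 𝔸@(A , inj₂ (U , (U-open , _) , c , _ , A⊆cU , cU⊆A)) =
    let E , near = open⇒∈-leftCoset U U-open
    in  E , λ {g} {h} g∈A h∈G h~g →
          let u , u∈U , g≈cu = A⊆cU {g} g∈A
              v , v∈U , h≈gv = near {g} {h} (𝓦-⊆ {G = G} 𝔸 {g} g∈A) h∈G h~g
          in  cU⊆A {h} (u ∙ v , ∙∈ U u∈U v∈U , λ x → trans (h≈gv x) (g≈cu (to v x)))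

  -- The pointwise limit of the approximating automorphisms.

  module Limit
    (G-closed : IsClosed ℕ-setoid ∣ G ∣) (V : Subgroup ℓ) (V-rp : IsRPOpenSubgroup G V)
    -- `ρ` is a separate parameter so that the module applies again with `π` and `ρ` exchanged.
    (π ρ : Inverse (𝓦 G) (𝓦 G)) (πρ≐id : LeftInverseOf π ρ)
    (approx : Approximable π) (approx⁻¹ : Approximable ρ)
    where

    -- Intersecting with `V` secures Roelcke precompactness, which the full stabiliser of `x` in `G`
    -- may lack.
    stab : ℕ → Subgroup ℓ
    stab x = fix G V (x ∷ [])

    stab-rp : ∀ x → IsRPOpenSubgroup G (stab x)
    stab-rp x = fix-isRPOpenSubgroup G V (x ∷ []) V-rp

    stabᵂ : ℕ → W
    stabᵂ x = coset (stab x) (stab-rp x) G.ε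

    δ : ℕ → Automorphism G
    δ x = proj₁ (approx⁻¹ (stabᵂ x ∷ []))

    -- As a set this is ρ(`stab x`), so `π` sends it to `stab x`. A value of `ρ` is a priori only a
    -- coset or empty; the image under `δ x` is visibly a subgroup.
    U : ℕ → Subgroup ℓ
    U x = imageSubgroup (δ x) (stab x)

    U-rp : ∀ x → IsRPOpenSubgroup G (U x)
    U-rp x = proj₁ (proj₂ (image-coset (δ x) (stab x , stab-rp x , ε , ε∈ G , ≐-refl)))

    Uᵂ : ℕ → W
    Uᵂ x = act (δ x) (stabᵂ x)

    π-Uᵂ : ∀ x → proj₁ (to π (Uᵂ x)) ≐ leftCoset ε (stab x)
    π-Uᵂ x = ≐-trans
      (to-cong π {Uᵂ x} {to ρ (stabᵂ x)} (All.head (proj₂ (approx⁻¹ (stabᵂ x ∷ [])))))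
      (πρ≐id (stabᵂ x))

    _·U_ : El G → ℕ → W
    g ·U x = coset (U x) (U-rp x) g

    -- Unfolding value makes the conversion checks for limitAutomorphism explode.
    opaque
      value : El G → ℕ → ℕ
      value g x = to (proj₁ (fun (proj₁ (approx (g ·U x ∷ Uᵂ x ∷ []))) g)) x

      -- For u in U, α(u) lies in α(U) = π(U) and so fixes `x`. Hence α(gu) = α(g)α(u) sends `x` to
      -- α(g)(x), and such elements exhaust α(gU) = π(gU).
      value-unique : ∀ g x {k} → k ∈ proj₁ (to π (g ·U x)) → to k x ≡ value g x
      value-unique g x {k} k∈πgU =
        -- The list is the one used in `value`, so α(g)(x) unfolds to `value g x`.
        let α , agrees = approx (g ·U x ∷ Uᵂ x ∷ [])
            αgU≐ , agrees′ = All.uncons agrees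
            αU≐ = All.head agrees′
            h , (u , u∈U@(s , s∈stab , δs≈u) , h≈gu) , αh≈k = proj₂ αgU≐ {k} k∈πgU
            u′ : El G
            u′ = u , proj₁ (proj₁ (U-rp x)) {u} u∈U
            αu = proj₁ (fun α u′)
            t , (_ , t~ε) , αu≈t = proj₁ (π-Uᵂ x) {αu} (proj₁ αU≐ {αu}
              (u′ , (s , (proj₁ s , s∈stab , λ _ → refl) , δs≈u) , λ _ → refl))
            open ≡-Reasoning
        in  begin
          to k x                            ≡⟨ αh≈k x ⟨
          to (proj₁ (fun α h)) x            ≡⟨ Automorphism.⟦⟧-cong α {h} {g G.∙ u′} h≈gu x ⟩
          to (proj₁ (fun α (g G.∙ u′))) x   ≡⟨ Automorphism.homo α g u′ x ⟩
          to (proj₁ (fun α g)) (to αu x)    ≡⟨ cong (to (proj₁ (fun α g))) (trans (αu≈t x) (All.head t~ε)) ⟩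
          value g x                         ∎

    -- Agreement on gU alone suffices: α(h) then lies in π(gU), where the value at `x` is constant.
    agrees⇒value : ∀ α g x → Agrees π α (g ·U x) → ∀ h → proj₁ h ∈ leftCoset (proj₁ g) (U x) →
      to (proj₁ (fun α h)) x ≡ value g x
    agrees⇒value α g x αgU≐ h h∈gU =
      value-unique g x {proj₁ (fun α h)} (proj₁ αgU≐ {proj₁ (fun α h)} (h , h∈gU , λ _ → refl))

    agrees⇒value-self : ∀ α g x → Agrees π α (g ·U x) → to (proj₁ (fun α g)) x ≡ value g x
    agrees⇒value-self α g x αgU≐ = agrees⇒value α g x αgU≐ g (∈-leftCoset (U x) (proj₁ g))

    -- A single `α` agreeing with `π` on both gU and hU computes both values.
    value-coset : ∀ g h x → proj₁ h ∈ leftCoset (proj₁ g) (U x) → value h x ≡ value g x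
    value-coset g h x h∈gU =
      let α , agrees = approx (g ·U x ∷ h ·U x ∷ [])
          αgU≐ , agrees′ = All.uncons agrees
          αhU≐ = All.head agrees′
      in  trans (sym (agrees⇒value-self α h x αhU≐)) (agrees⇒value α g x αgU≐ h h∈gU)

    value-cong : ∀ g h → g G.≈ h → ∀ x → value g x ≡ value h x
    value-cong g h g≈h x = value-coset h g x (ε , ε∈ (U x) , g≈h)

    value-∙ : ∀ g h x → value (g G.∙ h) x ≡ value g (value h x)
    value-∙ g h x =
      -- α(g) will be evaluated at `y`, so its coset is taken with respect to `U y`.
      let y = value h x
          α , agrees = approx ((g G.∙ h) ·U x ∷ h ·U x ∷ g ·U y ∷ [])
          αghU≐ , agrees′ = All.uncons agrees
          αhU≐ , agrees″ = All.uncons agrees′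
          αgU≐ = All.head agrees″
          open ≡-Reasoning
      in  begin
        value (g G.∙ h) x                                   ≡⟨ agrees⇒value-self α (g G.∙ h) x αghU≐ ⟨
        to (proj₁ (fun α (g G.∙ h))) x                      ≡⟨ Automorphism.homo α g h x ⟩
        to (proj₁ (fun α g)) (to (proj₁ (fun α h)) x)       ≡⟨ cong (to (proj₁ (fun α g))) (agrees⇒value-self α h x αhU≐) ⟩
        to (proj₁ (fun α g)) y                              ≡⟨ agrees⇒value-self α g y αgU≐ ⟩
        value g y                                           ∎

    value-ε : ∀ x → value G.ε x ≡ x
    value-ε x =
      let α , agrees = approx (G.ε ·U x ∷ [])
      in  trans (sym (agrees⇒value-self α G.ε x (All.head agrees))) (Automorphism.ε-homo α x)

    value-inverse : ∀ g h → g G.∙ h G.≈ G.ε → ∀ x → value g (value h x) ≡ x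
    value-inverse g h gh≈ε x =
      trans (sym (value-∙ g h x)) (trans (value-cong (g G.∙ h) G.ε gh≈ε x) (value-ε x))

    limitPerm : El G → Perm
    limitPerm g = record
      { to        = value g
      ; from      = value (g G.⁻¹)
      ; to-cong   = cong (value g)
      ; from-cong = cong (value (g G.⁻¹))
      ; inverse   =
          (λ { refl → value-inverse g (g G.⁻¹) (G.inverseʳ g) _ }) ,
          (λ { refl → value-inverse (g G.⁻¹) g (G.inverseˡ g) _ })
      }

    limitPerm-near : ∀ g F α → All (Agrees π α) (map (g ·U_) F) → limitPerm g ~[ F ] proj₁ (fun α g)
    limitPerm-near g F α agrees =
      All.map (λ {x} αgU≐ → sym (agrees⇒value-self α g x αgU≐)) (map⁻ agrees)

    limit : El G → El G
    limit g = limitPerm g , G-closed (limitPerm g) λ F →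
      let α , agrees = approx (map (g ·U_) F)
      in  proj₁ (fun α g) , proj₂ (fun α g) , limitPerm-near g F α agrees

    limit-continuous : IsContinuous G limit
    limit-continuous g []      = [] , λ _ _ → []
    limit-continuous g (x ∷ F) =
      let E , near = open⇒∈-leftCoset (U x) (proj₁ (U-rp x))
          D , p    = limit-continuous g F
      in  E ++ D , λ h h~g →
            value-coset g h x (near {proj₁ g} {proj₁ h} (proj₂ g) (proj₂ h) (++⁻ˡ E h~g))
            ∷ p h (++⁻ʳ E h~g)

    limit∈ : ∀ (A : W) g → proj₁ g ∈ proj₁ A → proj₁ (limit g) ∈ proj₁ (to π A)
    limit∈ A g g∈A =
      -- `α` is chosen after `E`, so `E` must work for whichever point α(g) of π(A) results; this
      -- needs uniformity.
      let E , near = 𝓦-uniformlyOpen (to π A)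
          α , agrees = approx (A ∷ map (g ·U_) E)
          αA≐ , agrees′ = All.uncons agrees
          αg = proj₁ (fun α g)
      in  near {αg} {limitPerm g} (proj₁ αA≐ {αg} (g , g∈A , λ _ → refl)) (proj₂ (limit g))
            (limitPerm-near g E α agrees′)

  -- The two limits as mutually inverse automorphisms.

  module LimitAutomorphism
    (G-closed : IsClosed ℕ-setoid ∣ G ∣) (V : Subgroup ℓ) (V-rp : IsRPOpenSubgroup G V)
    where

    -- The double limit of `g` stays in πρ(`gStab`), that is in `gStab`, whose elements all agree
    -- with `g` at `x`.
    limit-limit : ∀ π ρ (πρ≐id : LeftInverseOf π ρ) (ρπ≐id : LeftInverseOf ρ π)
      (p : Approximable π) (q : Approximable ρ) → ∀ g →
      Limit.limit G-closed V V-rp π ρ πρ≐id p q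
        (Limit.limit G-closed V V-rp ρ π ρπ≐id q p g) G.≈ g
    limit-limit π ρ πρ≐id ρπ≐id p q g x =
      let module β = Limit G-closed V V-rp π ρ πρ≐id p q
          module γ = Limit G-closed V V-rp ρ π ρπ≐id q p
          gStab = coset (β.stab x) (β.stab-rp x) g
          γg = γ.limit g
          βγg = β.limitPerm γg
          s , (_ , s~ε) , βγg≈gs = proj₁ (πρ≐id gStab) {βγg}
            (β.limit∈ (to ρ gStab) γg
              (γ.limit∈ gStab g (∈-leftCoset (β.stab x) (proj₁ g))))
      in  trans (βγg≈gs x) (cong (to (proj₁ g)) (All.head s~ε))

    module _
      (π ρ : Inverse (𝓦 G) (𝓦 G)) (πρ≐id : LeftInverseOf π ρ) (ρπ≐id : LeftInverseOf ρ π)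
      (approx : Approximable π) (approx⁻¹ : Approximable ρ)
      where
      private
        module β = Limit G-closed V V-rp π ρ πρ≐id approx approx⁻¹
        module γ = Limit G-closed V V-rp ρ π ρπ≐id approx⁻¹ approx

        βγ : ∀ g → β.limit (γ.limit g) G.≈ g
        βγ = limit-limit π ρ πρ≐id ρπ≐id approx approx⁻¹

        γβ : ∀ g → γ.limit (β.limit g) G.≈ g
        γβ = limit-limit ρ π ρπ≐id πρ≐id approx⁻¹ approx

      limitAutomorphism : Automorphism G
      limitAutomorphism = record
        { bijection       = record
          { to        = β.limit
          ; from      = γ.limit
          ; to-cong   = λ {g} {h} → β.value-cong g h
          ; from-cong = λ {g} {h} → γ.value-cong g h
          ; inverse   =
              (λ {g} {h} h≈γg x → trans (β.value-cong h (γ.limit g) h≈γg x) (βγ g x)) ,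
              (λ {g} {h} h≈βg x → trans (γ.value-cong h (β.limit g) h≈βg x) (γβ g x))
          }
        ; isHomomorphism  = record
          { isMonoidHomomorphism = record
            { isMagmaHomomorphism = record
              { isRelHomomorphism = record { cong = λ {g} {h} → β.value-cong g h }
              ; homo = β.value-∙
              }
            ; ε-homo = β.value-ε
            }
          -- `limitPerm` takes the values at the inverse of `g` as its `from`.
          ; ⁻¹-homo = λ _ _ → refl
          }
        ; to-continuous   = β.limit-continuous
        ; from-continuous = γ.limit-continuous
        }

      Γ-limitAutomorphism : ∀ A → image limitAutomorphism (proj₁ A) ≐ proj₁ (to π A)
      Γ-limitAutomorphism A =
        (λ { {k} (g , g∈A , βg≈k) →
             𝓦-resp {G = G} (to π A) {β.limitPerm g} {k} βg≈k (β.limit∈ A g g∈A) }) ,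
        -- The preimage of `k` is its limit under `ρ`, which lies in ρ(π(A)) = A.
        (λ {k} k∈πA →
          let k′ = k , 𝓦-⊆ {G = G} (to π A) {k} k∈πA
              γk = γ.limit k′
          in  γk , proj₁ (ρπ≐id A) {proj₁ γk} (γ.limit∈ (to π A) k′ k∈πA) , βγ k′)

proposition6p9 : ∀ {ℓ : Level} (G : Subgroup ℓ) →
    Infinite (Subgroup.setoid G) →
    IsClosed ℕ-setoid (Subgroup.∣_∣ G) →
    LocallyRoelckePrecompact G →
    IsClosed (𝓦 G) (Range-Γ G)
proposition6p9 G _ G-closed (V , V-rp) π near =
  limitAutomorphism π ρ πρ≐id ρπ≐id approx approx⁻¹ ,
  Γ-limitAutomorphism π ρ πρ≐id ρπ≐id approx approx⁻¹
  where
  open LimitAutomorphism G G-closed V V-rp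
  ρ = Symm.inverse π
  πρ≐id = strictlyInverseˡ π
  ρπ≐id = strictlyInverseʳ π
  approx = closure⇒approximable G π near
  approx⁻¹ = approximable-inverse G π approx
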